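{- There exists an absolute constant $c>0$ such that for every sufficiently large prime power $q$ and every integer $m\ge q^{1/2}(\log q)^2$, the number of general position sets of size $m$ in $\mathbb{F}_q^2$ is at most $\binom{cq}{m}$.
   Context: $\mathbb{F}_q$ is the finite field with $q$ elements. A point set in $\mathbb{F}_q^2$ is in general position if no three of its points lie on a common line. $\log$ is in base $2$. -}

module Defs where

open import Data.Nat using (ℕ)
import Data.Nat as N
open import Data.Fin using (Fin)
open import Data.Product using (Σ; _×_; ∃-syntax; _,_)
open import Data.Bool using (Bool; true; false)
open import Data.Vec using (Vec; lookup; count)
open import Data.List using (List; length)
open import Data.Sum using (_⊎_)
open import Relation.Nullary using (¬_)
open import Relation.Binary.PropositionalEquality using (_≡_; _≢_)
open import Algebra.Structures using (IsCommutativeRing)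
open import Algebra.Core using (Op₁; Op₂)

-- A field whose carrier is Fin q (so it has exactly q elements), with
-- propositional equality.  Any finite field of order q is isomorphic to
-- one of this form.
record FiniteField (q : ℕ) : Set where
  field
    _+_ _*_ : Op₂ (Fin q)
    -_      : Op₁ (Fin q)
    0# 1#   : Fin q
    isCommutativeRing : IsCommutativeRing _≡_ _+_ _*_ -_ 0# 1#
    0≢1     : 0# ≢ 1#
    inverse : ∀ x → x ≢ 0# → ∃[ y ] (x * y ≡ 1#)

Point : ℕ → Set
Point q = Fin q × Fin q

PlaneSubset : ℕ → Set
PlaneSubset q = Vec (Vec Bool q) q

_∈ₚ_ : ∀ {q} → Point q → PlaneSubset q → Set
(x , y) ∈ₚ S = lookup (lookup S x) y ≡ true

size : ∀ {q} → PlaneSubset q → ℕ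
size S = Data.Vec.sum (Data.Vec.map (count (λ b → Data.Bool._≟_ b true)) S)
  where import Data.Bool

module _ {q : ℕ} (F : FiniteField q) where
  open FiniteField F

  OnLine : Fin q → Fin q → Fin q → Point q → Set
  OnLine a b c (x , y) = (a * x) + (b * y) ≡ c

  Collinear : Point q → Point q → Point q → Set
  Collinear P Q R = ∃[ a ] ∃[ b ] ∃[ c ]
    (¬ (a ≡ 0# × b ≡ 0#) × OnLine a b c P × OnLine a b c Q × OnLine a b c R)

  GeneralPosition : PlaneSubset q → Set
  GeneralPosition S = ∀ P Q R → P ∈ₚ S → Q ∈ₚ S → R ∈ₚ S →
    P ≢ Q → Q ≢ R → P ≢ R → ¬ Collinear P Q R

-- log₂ q ≤ √(m / √q), i.e. m ≥ q^{1/2} (log₂ q)^2, phrased without reals: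
-- every nonnegative rational a/b below log₂ q (i.e. 2^a < q^b) is below
-- √(m/√q) (i.e. a^4 · q < m^2 · b^4).
LargeEnough : ℕ → ℕ → Set
LargeEnough q m = ∀ a b → 0 N.< b → 2 N.^ a N.< q N.^ b →
  (a N.^ 4) N.* q N.< (m N.^ 2) N.* (b N.^ 4)

module Submission where

-- Given a set T of already chosen points, join two available points when they are collinear with a point of T.
-- An arc containing T meets the available points in an independent set. By Cauchy–Schwarz over the q + 1 lines
-- through each point of T, once |T| ≥ p any A with |A| ≥ 2 (q + 1) contains a vertex v whose choice leaves at most
-- |A| / (1 + p / 2 (q + 1)) available points. Branching on whether an arc contains v (Kleitman–Winston), p arbitrary
-- choices followed by t choices of such v reduce the q² points to 2 (q + 1), so the number of arcs is at most
-- (q² + 1)^(p + t) · C(2 (q + 1) + p + t, m). With p ~ √q and t ~ √q log q the first factor is 2^O(m), and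
-- c^m · C(n, m) ≤ C(c n, m) absorbs it.

open import Defs
open import Algebra.Bundles using (CommutativeRing)
import Algebra.Properties.Group as GroupProperties
import Algebra.Solver.Ring.NaturalCoefficients.Default as SemiringSolver
open import Data.Bool using (Bool; true; false)
import Data.Bool as Bool
open import Data.Fin using (Fin)
import Data.Fin as Fin
open import Data.List using (List; []; _∷_; length; map; filter; allFin; cartesianProduct; _++_)
open import Data.List.Membership.Propositional using (_∈_)
open import Data.List.Membership.Propositional.Properties using (∈-allFin; ∈-∃++; ∈-filter⁻; ∈-filter⁺; ∈-cartesianProduct⁺)
open import Data.List.Properties using (map-∘; map-++; length-filter; length-tabulate; map-tabulate; filter-reject)
open import Data.List.Relation.Binary.Permutation.Propositional using (_↭_; ↭⇒↭ₛ)
open import Data.List.Relation.Binary.Permutation.Propositional.Properties as ↭ using (All-resp-↭; ∈-resp-↭; ↭-length; filter-↭)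
open import Data.List.Relation.Binary.Permutation.Setoid.Properties using (Unique-resp-↭)
open import Data.List.Relation.Unary.All as All using (All; []; _∷_; all?)
import Data.List.Relation.Unary.All.Properties as All
open import Data.List.Relation.Unary.AllPairs using ([]; _∷_)
open import Data.List.Relation.Unary.Any using (here; there)
open import Data.List.Relation.Unary.Unique.Propositional using (Unique)
open import Data.List.Relation.Unary.Unique.Propositional.Properties using (allFin⁺; filter⁺; cartesianProduct⁺)
open import Data.Nat using (ℕ; zero; suc; _+_; _*_; _∸_; _^_; _≤_; _<_; z≤n; s≤s; _≤?_; NonZero)
open import Data.Nat.Combinatorics using (_C_; nCk+nC[k+1]≡[n+1]C[k+1])
open import Data.Nat.ListAction using (sum)
open import Data.Nat.ListAction.Properties using (sum-↭; sum-++)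
open import Data.Nat.Properties hiding (_≟_)
open import Data.Nat.Tactic.RingSolver using (solve-∀)
open import Data.Product using (_×_; _,_; ∃-syntax; proj₁; proj₂)
open import Data.Product.Properties using (≡-dec)
open import Data.Vec using (Vec; []; _∷_; lookup)
import Data.Vec as Vec
open import Data.Vec.Properties using (lookup-map; tabulate∘lookup; tabulate-cong)
open import Function using (_∘_; id)
open import Relation.Binary using (DecidableEquality)
open import Relation.Binary.PropositionalEquality using (_≡_; _≢_; refl; sym; trans; cong; cong₂; subst; ≢-sym; setoid; module ≡-Reasoning)
open import Relation.Nullary using (¬_; Dec; yes; no; does; contradiction; ¬?; _×-dec_)
open import Relation.Nullary.Decidable using (dec-true; dec-false)
open import Relation.Unary using (Decidable)

-- Finite sums over lists.

private variable
  X Y : Set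

∑ : List X → (X → ℕ) → ℕ
∑ xs f = sum (map f xs)

⟦_⟧ : Bool → ℕ
⟦ true ⟧  = 1
⟦ false ⟧ = 0

⟦⟧≤1 : ∀ b → ⟦ b ⟧ ≤ 1
⟦⟧≤1 true  = ≤-refl
⟦⟧≤1 false = z≤n

⟦does⟧+≤1 : ∀ {P : Set} (P? : Dec P) {k} → k ≤ 1 → (P → k ≡ 0) → ⟦ does P? ⟧ + k ≤ 1
⟦does⟧+≤1 (yes p) _   k≡0 = ≤-reflexive (cong suc (k≡0 p))
⟦does⟧+≤1 (no _)  k≤1 _   = k≤1

∑-mono : ∀ (xs : List X) {f g : X → ℕ} → (∀ {x} → x ∈ xs → f x ≤ g x) → ∑ xs f ≤ ∑ xs g
∑-mono []       f≤g = z≤n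
∑-mono (x ∷ xs) f≤g = +-mono-≤ (f≤g (here refl)) (∑-mono xs (f≤g ∘ there))

∑-cong : ∀ (xs : List X) {f g : X → ℕ} → (∀ {x} → x ∈ xs → f x ≡ g x) → ∑ xs f ≡ ∑ xs g
∑-cong xs f≡g = ≤-antisym (∑-mono xs (≤-reflexive ∘ f≡g)) (∑-mono xs (≤-reflexive ∘ sym ∘ f≡g))

∑-+ : ∀ (xs : List X) (f g : X → ℕ) → ∑ xs (λ x → f x + g x) ≡ ∑ xs f + ∑ xs g
∑-+ []       f g = refl
∑-+ (x ∷ xs) f g rewrite ∑-+ xs f g = interchange (f x) (g x) (∑ xs f) (∑ xs g)
  where
  interchange : ∀ a b c d → a + b + (c + d) ≡ a + c + (b + d)
  interchange = solve-∀

∑-*ˡ : ∀ (xs : List X) k (f : X → ℕ) → ∑ xs (λ x → k * f x) ≡ k * ∑ xs f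
∑-*ˡ []       k f = sym (*-zeroʳ k)
∑-*ˡ (x ∷ xs) k f rewrite ∑-*ˡ xs k f = sym (*-distribˡ-+ k (f x) (∑ xs f))

∑-const : ∀ (xs : List X) k → ∑ xs (λ _ → k) ≡ length xs * k
∑-const []       k = refl
∑-const (x ∷ xs) k = cong (k +_) (∑-const xs k)

∑-≤-const : ∀ (xs : List X) {f : X → ℕ} k → (∀ {x} → x ∈ xs → f x ≤ k) → ∑ xs f ≤ length xs * k
∑-≤-const xs k f≤k = ≤-trans (∑-mono xs f≤k) (≤-reflexive (∑-const xs k))

∑-swap : ∀ (xs : List X) (ys : List Y) (f : X → Y → ℕ) →
         ∑ xs (λ x → ∑ ys (f x)) ≡ ∑ ys (λ y → ∑ xs (λ x → f x y))
∑-swap []       ys f = sym (trans (∑-const ys 0) (*-zeroʳ (length ys)))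
∑-swap (x ∷ xs) ys f = trans (cong (∑ ys (f x) +_) (∑-swap xs ys f))
                             (sym (∑-+ ys (f x) (λ y → ∑ xs (λ x′ → f x′ y))))

∑-map : ∀ (f : X → Y) (g : Y → ℕ) xs → ∑ (map f xs) g ≡ ∑ xs (g ∘ f)
∑-map f g xs = cong sum (sym (map-∘ xs))

∑-↭ : ∀ {xs ys : List X} (f : X → ℕ) → xs ↭ ys → ∑ xs f ≡ ∑ ys f
∑-↭ f xs↭ys = sum-↭ (↭.map⁺ f xs↭ys)

∑-cartesianProduct : ∀ (xs : List X) (ys : List Y) (f : X → Y → ℕ) →
  ∑ (cartesianProduct xs ys) (λ (x , y) → f x y) ≡ ∑ xs (λ x → ∑ ys (f x))
∑-cartesianProduct []       ys f = refl
∑-cartesianProduct (x ∷ xs) ys f = begin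
  sum (map g (map (x ,_) ys ++ rest))        ≡⟨ cong sum (map-++ g (map (x ,_) ys) rest) ⟩
  sum (map g (map (x ,_) ys) ++ map g rest)  ≡⟨ sum-++ (map g (map (x ,_) ys)) (map g rest) ⟩
  sum (map g (map (x ,_) ys)) + ∑ rest g     ≡⟨ cong₂ (λ zs k → sum zs + k) (sym (map-∘ ys)) (∑-cartesianProduct xs ys f) ⟩
  ∑ ys (f x) + ∑ xs (λ x → ∑ ys (f x))       ∎
  where
  open ≡-Reasoning
  rest = cartesianProduct xs ys
  g = λ (x , y) → f x y

length-filter≡∑ : ∀ {P : X → Set} (P? : Decidable P) xs → length (filter P? xs) ≡ ∑ xs (λ x → ⟦ does (P? x) ⟧)
length-filter≡∑ P? []       = refl
length-filter≡∑ P? (x ∷ xs) with does (P? x)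
... | true  = cong suc (length-filter≡∑ P? xs)
... | false = length-filter≡∑ P? xs

∑-filter : ∀ {P : X → Set} (P? : Decidable P) (f : X → ℕ) xs → (∀ {x} → x ∈ xs → ¬ P x → f x ≡ 0) →
           ∑ (filter P? xs) f ≡ ∑ xs f
∑-filter P? f []       off = refl
∑-filter P? f (x ∷ xs) off with P? x
... | yes _ = cong (f x +_) (∑-filter P? f xs (off ∘ there))
... | no ¬p rewrite off (here refl) ¬p = ∑-filter P? f xs (off ∘ there)

-- Averaging: a first entry above `b` leaves the rest with a sum of at most `b` per entry. Passing
-- the head separately makes the list nonempty.
∑-∃≤ : ∀ x (xs : List X) (f : X → ℕ) b → ∑ (x ∷ xs) f ≤ length (x ∷ xs) * b → ∃[ y ] (y ∈ x ∷ xs × f y ≤ b)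
∑-∃≤ x xs f b ∑≤ with f x ≤? b
... | yes fx≤b = x , here refl , fx≤b
∑-∃≤ x []       f b ∑≤ | no fx≰b =
  contradiction (subst (_≤ b) (+-identityʳ (f x)) (≤-trans ∑≤ (≤-reflexive (+-identityʳ b)))) fx≰b
∑-∃≤ x (y ∷ xs) f b ∑≤ | no fx≰b =
  let z , z∈ , fz≤b = ∑-∃≤ y xs f b (+-cancelˡ-≤ b _ _ (≤-trans (+-monoˡ-≤ _ (<⇒≤ (≰⇒> fx≰b))) ∑≤))
  in z , there z∈ , fz≤b

module _ (_≟_ : DecidableEquality X) where

  ∑-≟-∉ : ∀ y xs → All (y ≢_) xs → ∑ xs (λ x → ⟦ does (y ≟ x) ⟧) ≡ 0
  ∑-≟-∉ y []       []            = refl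
  ∑-≟-∉ y (x ∷ xs) (y≢x ∷ y∉xs) rewrite dec-false (y ≟ x) y≢x = ∑-≟-∉ y xs y∉xs

  ∑-≟-unique : ∀ y {xs} → Unique xs → ∑ xs (λ x → ⟦ does (y ≟ x) ⟧) ≤ 1
  ∑-≟-unique y {[]}     []               = z≤n
  ∑-≟-unique y {x ∷ xs} (x∉xs ∷ unique) with y ≟ x
  ... | yes refl = ≤-reflexive (cong suc (∑-≟-∉ y xs x∉xs))
  ... | no _     = ∑-≟-unique y unique

  ∑-≟-∈ : ∀ {y xs} → y ∈ xs → 1 ≤ ∑ xs (λ x → ⟦ does (y ≟ x) ⟧)
  ∑-≟-∈ {y} (here refl) rewrite dec-true (y ≟ y) refl = s≤s z≤n
  ∑-≟-∈ {y} {x ∷ xs} (there y∈xs) = ≤-trans (∑-≟-∈ y∈xs) (m≤n+m _ ⟦ does (y ≟ x) ⟧)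

∈⇒↭∷ : ∀ {x : X} {xs} → x ∈ xs → ∃[ ys ] xs ↭ x ∷ ys
∈⇒↭∷ x∈xs with ys , zs , refl ← ∈-∃++ x∈xs = ys ++ zs , ↭.shift _ ys zs

-- Cauchy-Schwarz by counting collisions.

-- Raising `m` and `n` by one adds `2 * (m + n + 1)` to either side, so the induction ends with one
-- of them zero and no difference is ever formed.
2*m*n≤m²+n² : ∀ m n → 2 * (m * n) ≤ m * m + n * n
2*m*n≤m²+n² zero    n       = z≤n
2*m*n≤m²+n² (suc m) zero    rewrite *-zeroʳ m = z≤n
2*m*n≤m²+n² (suc m) (suc n) = begin
  2 * (suc m * suc n)                         ≡⟨ lhs m n ⟩
  2 * (m * n) + 2 * (m + n + 1)               ≤⟨ +-monoˡ-≤ _ (2*m*n≤m²+n² m n) ⟩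
  m * m + n * n + 2 * (m + n + 1)             ≡⟨ rhs m n ⟩
  suc m * suc m + suc n * suc n               ∎
  where
  open ≤-Reasoning
  lhs : ∀ m n → 2 * ((1 + m) * (1 + n)) ≡ 2 * (m * n) + 2 * (m + n + 1)
  lhs = solve-∀
  rhs : ∀ m n → m * m + n * n + 2 * (m + n + 1) ≡ (1 + m) * (1 + m) + (1 + n) * (1 + n)
  rhs = solve-∀

-- Cauchy–Schwarz for the fibre sizes of f.
length²≤∑-collisions : ∀ {n} (f : X → Fin n) (xs : List X) →
  length xs * length xs ≤ n * ∑ xs (λ x → ∑ xs (λ y → ⟦ does (f x Fin.≟ f y) ⟧))
length²≤∑-collisions {n = zero}  f []       = z≤n
length²≤∑-collisions {n = zero}  f (x ∷ xs) with () ← f x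
length²≤∑-collisions {n = n@(suc _)} f xs = *-cancelˡ-≤ n (begin
  n * (a * a)
    ≤⟨ +-cancelˡ-≤ (n * (a * a)) _ _ (begin
      n * (a * a) + n * (a * a)                              ≡⟨ double n a ⟩
      2 * (n * a) * a                                        ≤⟨ *-monoʳ-≤ (2 * (n * a)) a≤∑c ⟩
      2 * (n * a) * ∑ js c                                   ≡⟨ ∑-*ˡ js (2 * (n * a)) c ⟨
      -- Pairing `a` with `n * c j` makes the inequality tight when all fibres have the mean size
      -- `a / n`. Summed over `j`, the squares of `a` give `n * (a * a)`, which cancels one of the
      -- two copies on the left.
      ∑ js (λ j → 2 * (n * a) * c j)                         ≤⟨ ∑-mono js (λ {j} _ → amgm (c j)) ⟩
      ∑ js (λ j → a * a + n * n * (c j * c j))               ≡⟨ ∑-+ js (λ _ → a * a) (λ j → n * n * (c j * c j)) ⟩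
      ∑ js (λ _ → a * a) + ∑ js (λ j → n * n * (c j * c j))  ≡⟨ cong₂ _+_ (trans (∑-const js (a * a)) (cong (_* (a * a)) length-js)) (∑-*ˡ js (n * n) _) ⟩
      n * (a * a) + n * n * ∑ js (λ j → c j * c j)           ≤⟨ +-monoʳ-≤ (n * (a * a)) (*-monoʳ-≤ (n * n) ∑c²≤) ⟩
      n * (a * a) + n * n * E                                ∎) ⟩
  n * n * E   ≡⟨ *-assoc n n E ⟩
  n * (n * E) ∎)
  where
  open ≤-Reasoning
  a = length xs
  js = allFin n
  E = ∑ xs (λ x → ∑ xs (λ y → ⟦ does (f x Fin.≟ f y) ⟧))
  c : Fin n → ℕ
  c j = ∑ xs (λ x → ⟦ does (f x Fin.≟ j) ⟧)

  length-js : length js ≡ n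
  length-js = length-tabulate {n = n} id

  double : ∀ n a → n * (a * a) + n * (a * a) ≡ 2 * (n * a) * a
  double = solve-∀

  amgm : ∀ k → 2 * (n * a) * k ≤ a * a + n * n * (k * k)
  amgm k = begin
    2 * (n * a) * k              ≡⟨ l n a k ⟩
    2 * (a * (n * k))            ≤⟨ 2*m*n≤m²+n² a (n * k) ⟩
    a * a + (n * k) * (n * k)    ≡⟨ r n a k ⟩
    a * a + n * n * (k * k)      ∎
    where
    l : ∀ n a k → 2 * (n * a) * k ≡ 2 * (a * (n * k))
    l = solve-∀
    r : ∀ n a k → a * a + (n * k) * (n * k) ≡ a * a + n * n * (k * k)
    r = solve-∀

  a≤∑c : a ≤ ∑ js c
  a≤∑c = begin
    a                                               ≡⟨ trans (∑-const xs 1) (*-identityʳ a) ⟨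
    ∑ xs (λ _ → 1)                                  ≤⟨ ∑-mono xs (λ {x} _ → ∑-≟-∈ Fin._≟_ (∈-allFin (f x))) ⟩
    ∑ xs (λ x → ∑ js (λ j → ⟦ does (f x Fin.≟ j) ⟧)) ≡⟨ ∑-swap xs js _ ⟩
    ∑ js c                                          ∎

  fibre : ∀ i k → ∑ js (λ j → ⟦ does (i Fin.≟ j) ⟧ * ⟦ does (k Fin.≟ j) ⟧) ≤ ⟦ does (i Fin.≟ k) ⟧
  fibre i k with i Fin.≟ k
  ... | yes refl = ≤-trans (∑-mono js (λ {j} _ → ≤-trans (*-monoʳ-≤ ⟦ does (i Fin.≟ j) ⟧ (⟦⟧≤1 _)) (≤-reflexive (*-identityʳ _))))
                           (∑-≟-unique Fin._≟_ i (allFin⁺ n))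
  ... | no i≢k = ≤-trans (∑-mono js (λ {j} _ → disjoint j)) (≤-reflexive (trans (∑-const js 0) (*-zeroʳ (length js))))
    where
    disjoint : ∀ j → ⟦ does (i Fin.≟ j) ⟧ * ⟦ does (k Fin.≟ j) ⟧ ≤ 0
    disjoint j with i Fin.≟ j | k Fin.≟ j
    ... | yes refl | yes refl = contradiction refl i≢k
    ... | yes _    | no _     = z≤n
    ... | no _     | _        = z≤n

  -- `c j * c j` counts the ordered pairs of entries in the fibre over `j`. With the sum over `j`
  -- innermost, a pair survives only if its two images agree.
  ∑c²≤ : ∑ js (λ j → c j * c j) ≤ E
  ∑c²≤ = begin
    ∑ js (λ j → c j * c j)
      ≡⟨ ∑-cong js (λ {j} _ → trans (sym (∑-*ˡ xs (c j) _)) (∑-cong xs (λ {x} _ → trans (*-comm (c j) _) (sym (∑-*ˡ xs ⟦ does (f x Fin.≟ j) ⟧ _))))) ⟩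
    ∑ js (λ j → ∑ xs (λ x → ∑ xs (λ y → ⟦ does (f x Fin.≟ j) ⟧ * ⟦ does (f y Fin.≟ j) ⟧)))
      ≡⟨ ∑-swap js xs _ ⟩
    ∑ xs (λ x → ∑ js (λ j → ∑ xs (λ y → ⟦ does (f x Fin.≟ j) ⟧ * ⟦ does (f y Fin.≟ j) ⟧)))
      ≡⟨ ∑-cong xs (λ _ → ∑-swap js xs _) ⟩
    ∑ xs (λ x → ∑ xs (λ y → ∑ js (λ j → ⟦ does (f x Fin.≟ j) ⟧ * ⟦ does (f y Fin.≟ j) ⟧)))
      ≤⟨ ∑-mono xs (λ {x} _ → ∑-mono xs (λ {y} _ → fibre (f x) (f y))) ⟩
    E ∎

-- Thinning by collinearity in an abstract linear space.

-- slope x y is the parallel class of the line through x and y; slope x x is junk.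
record LinearSpace (V : Set) (n : ℕ) : Set where
  field
    _≟_       : DecidableEquality V
    slope     : V → V → Fin n
    slope-sym : ∀ x y → slope x y ≡ slope y x
    slope-transfer : ∀ {x y z} → x ≢ y → y ≢ z → x ≢ z → slope x y ≡ slope x z → slope y z ≡ slope y x

module Thinning {V : Set} {n : ℕ} (L : LinearSpace V n) where
  open LinearSpace L

  -- The lines joining x to the points of T are pairwise distinct, so each further point lies on at most one of them;
  -- this makes the degree of x the sum of its degrees along the points of T, without overcounting.
  Extends : List V → V → Set
  Extends T x = All (x ≢_) T × Unique (map (slope x) T)

  -- The non-neighbours of `v` in the collinearity graph of `T`. The test is made from `x`, which is
  -- exactly what `Extends (v ∷ T) x` asks beyond `Extends T x`.
  Free : List V → V → V → Set
  Free T v x = x ≢ v × All (λ p → slope x v ≢ slope x p) T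

  free? : ∀ T v → Decidable (Free T v)
  free? T v x = ¬? (x ≟ v) ×-dec all? (λ p → ¬? (slope x v Fin.≟ slope x p)) T

  thin : List V → V → List V → List V
  thin T v = filter (free? T v)

  thin-extends : ∀ T v A → All (Extends T) A → All (Extends (v ∷ T)) (thin T v A)
  thin-extends T v A ext = All.tabulate λ {x} x∈ →
    let x∈A , x≢v , free = ∈-filter⁻ (free? T v) {xs = A} x∈
        x∉T , unique     = All.lookup ext x∈A
    in x≢v ∷ x∉T , All.map⁺ free ∷ unique

  ∑-collinear : List V → V → V → ℕ
  ∑-collinear T v x = ∑ T (λ p → ⟦ does (slope x v Fin.≟ slope x p) ⟧)

  -- The lines from `x` to the points of `T` are distinct, so the line from `x` to `v` is at most
  -- one of them, and none of them when `x` is free.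
  free+collinear≤1 : ∀ T v {x} → Extends T x → ⟦ does (free? T v x) ⟧ + ∑-collinear T v x ≤ 1
  free+collinear≤1 T v {x} (_ , unique)
    rewrite sym (∑-map (slope x) (λ d → ⟦ does (slope x v Fin.≟ d) ⟧) T) =
    ⟦does⟧+≤1 (free? T v x) (∑-≟-unique Fin._≟_ (slope x v) unique)
      (λ (_ , free) → ∑-≟-∉ Fin._≟_ (slope x v) (map (slope x) T) (All.map⁺ free))

  -- Cauchy-Schwarz counts collinear triples from `p`, whereas degrees are counted from `x`;
  -- `slope-transfer` changes the base point. The last term pays for the degenerate case `v ≡ x`.
  same-slope-from : ∀ {p v x} → p ≢ v → p ≢ x →
    ⟦ does (slope p v Fin.≟ slope p x) ⟧ ≤ ⟦ does (slope x v Fin.≟ slope x p) ⟧ + ⟦ does (v ≟ x) ⟧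
  same-slope-from {p} {v} {x} p≢v p≢x with slope p v Fin.≟ slope p x | v ≟ x
  ... | no _     | _        = z≤n
  ... | yes _    | yes refl = m≤n+m 1 _
  ... | yes same | no v≢x
    rewrite dec-true (slope x v Fin.≟ slope x p) (slope-transfer p≢x (≢-sym v≢x) p≢v (sym same)) = ≤-refl

  module _ {T A : List V} (unique : Unique A) (ext : All (Extends T) A) where
    private
      a = length A
      τ = length T
      G = ∑ A (λ v → length (thin T v A))

    -- Double count of the pairs `(v , x)`: being free and being collinear with a point of `T`
    -- contribute at most 1 together, and a diagonal pair adds at most `τ` more.
    ∑-thin+collisions : G + ∑ T (λ p → ∑ A (λ v → ∑ A (λ x → ⟦ does (slope p v Fin.≟ slope p x) ⟧))) ≤ a * a + τ * a
    ∑-thin+collisions = begin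
      G + ∑ T (λ p → ∑ A (λ v → ∑ A (λ x → e p v x)))
        ≡⟨ cong₂ _+_ (∑-cong A (λ {v} _ → length-filter≡∑ (free? T v) A))
                     (trans (∑-swap T A _) (∑-cong A (λ _ → ∑-swap T A _))) ⟩
      ∑ A (λ v → ∑ A (λ x → g v x)) + ∑ A (λ v → ∑ A (λ x → ∑ T (λ p → e p v x)))
        ≡⟨ trans (∑-cong A (λ {v} _ → ∑-+ A (g v) _)) (∑-+ A _ _) ⟨
      ∑ A (λ v → ∑ A (λ x → g v x + ∑ T (λ p → e p v x)))
        ≤⟨ ∑-mono A (λ v∈ → ∑-mono A (λ x∈ → pairwise v∈ x∈)) ⟩
      ∑ A (λ v → ∑ A (λ x → 1 + τ * ⟦ does (v ≟ x) ⟧))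
        ≡⟨ ∑-cong A (λ {v} _ → trans (∑-+ A (λ _ → 1) _) (cong₂ _+_ (trans (∑-const A 1) (*-identityʳ a)) (∑-*ˡ A τ _))) ⟩
      ∑ A (λ v → a + τ * ∑ A (λ x → ⟦ does (v ≟ x) ⟧))
        ≤⟨ ∑-≤-const A (a + τ) (λ {v} _ → +-monoʳ-≤ a (≤-trans (*-monoʳ-≤ τ (∑-≟-unique _≟_ v unique)) (≤-reflexive (*-identityʳ τ)))) ⟩
      a * (a + τ)
        ≡⟨ trans (*-distribˡ-+ a a τ) (cong (a * a +_) (*-comm a τ)) ⟩
      a * a + τ * a ∎
      where
      open ≤-Reasoning
      g : V → V → ℕ
      g v x = ⟦ does (free? T v x) ⟧
      e : V → V → V → ℕ
      e p v x = ⟦ does (slope p v Fin.≟ slope p x) ⟧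

      pairwise : ∀ {v x} → v ∈ A → x ∈ A → g v x + ∑ T (λ p → e p v x) ≤ 1 + τ * ⟦ does (v ≟ x) ⟧
      pairwise {v} {x} v∈A x∈A = begin
        g v x + ∑ T (λ p → e p v x)
          ≤⟨ +-monoʳ-≤ (g v x) (∑-mono T (λ p∈T → same-slope-from (p≢ v∈A p∈T) (p≢ x∈A p∈T))) ⟩
        g v x + ∑ T (λ p → ⟦ does (slope x v Fin.≟ slope x p) ⟧ + ⟦ does (v ≟ x) ⟧)
          ≡⟨ cong (g v x +_) (trans (∑-+ T _ (λ _ → ⟦ does (v ≟ x) ⟧)) (cong (∑-collinear T v x +_) (∑-const T _))) ⟩
        g v x + (∑-collinear T v x + τ * ⟦ does (v ≟ x) ⟧)
          ≡⟨ +-assoc (g v x) _ _ ⟨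
        g v x + ∑-collinear T v x + τ * ⟦ does (v ≟ x) ⟧
          ≤⟨ +-monoˡ-≤ _ (free+collinear≤1 T v (All.lookup ext x∈A)) ⟩
        1 + τ * ⟦ does (v ≟ x) ⟧ ∎
        where
        p≢ : ∀ {y p} → y ∈ A → p ∈ T → p ≢ y
        p≢ y∈A p∈T = ≢-sym (All.lookup (proj₁ (All.lookup ext y∈A)) p∈T)

    -- Cauchy-Schwarz over the `n` slopes at each point of `T` gives at least `τ * (a * a)` for `n`
    -- times the collisions. Doubling leaves one spare copy of `τ * (a * a)`, which absorbs the
    -- diagonal term `2 * n * τ * a` because `2 * n ≤ a`.
    ∑-thin-≤ : 2 * n ≤ a → 2 * n * G + τ * (a * a) ≤ 2 * n * (a * a)
    ∑-thin-≤ 2n≤a = +-cancelʳ-≤ (τ * (a * a)) _ _ (begin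
      2 * n * G + τ * (a * a) + τ * (a * a)    ≡⟨ l n G τ (a * a) ⟩
      2 * (n * G + τ * (a * a))                ≤⟨ *-monoʳ-≤ 2 (+-monoʳ-≤ (n * G) (begin
        τ * (a * a)                              ≤⟨ ≤-trans (≤-reflexive (sym (∑-const T (a * a)))) (∑-mono T (λ {p} _ → length²≤∑-collisions (slope p) A)) ⟩
        ∑ T (λ p → n * E p)                      ≡⟨ ∑-*ˡ T n E ⟩
        n * ∑ T E                                ∎)) ⟩
      2 * (n * G + n * ∑ T E)                  ≡⟨ cong (2 *_) (*-distribˡ-+ n G (∑ T E)) ⟨
      2 * (n * (G + ∑ T E))                    ≤⟨ *-monoʳ-≤ 2 (*-monoʳ-≤ n ∑-thin+collisions) ⟩
      2 * (n * (a * a + τ * a))                ≡⟨ m n a τ ⟩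
      2 * n * (a * a) + τ * (2 * n * a)        ≤⟨ +-monoʳ-≤ (2 * n * (a * a)) (*-monoʳ-≤ τ (*-monoˡ-≤ a 2n≤a)) ⟩
      2 * n * (a * a) + τ * (a * a)            ∎)
      where
      open ≤-Reasoning
      E : V → ℕ
      E p = ∑ A (λ v → ∑ A (λ x → ⟦ does (slope p v Fin.≟ slope p x) ⟧))
      l : ∀ n G τ b → 2 * n * G + τ * b + τ * b ≡ 2 * (n * G + τ * b)
      l = solve-∀
      m : ∀ n a τ → 2 * (n * (a * a + τ * a)) ≡ 2 * n * (a * a) + τ * (2 * n * a)
      m = solve-∀

    ∃-thinning-vertex : ∀ p → p ≤ τ → 2 * n ≤ a → 0 < a →
      ∃[ v ] (v ∈ A × (2 * n + p) * length (thin T v A) ≤ 2 * n * a)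
    ∃-thinning-vertex p p≤τ 2n≤a 0<a = average A refl ∑≤
      where
      open ≤-Reasoning
      f : V → ℕ
      f v = (2 * n + p) * length (thin T v A)

      average : ∀ B → A ≡ B → ∑ B f ≤ length B * (2 * n * a) → ∃[ v ] (v ∈ B × f v ≤ 2 * n * a)
      average []      refl _  = contradiction 0<a (<-irrefl refl)
      average (x ∷ B) A≡ ∑≤ = ∑-∃≤ x B f (2 * n * a) ∑≤

      ∑≤ : ∑ A f ≤ a * (2 * n * a)
      ∑≤ = begin
        ∑ A f                        ≡⟨ ∑-*ˡ A (2 * n + p) _ ⟩
        (2 * n + p) * G              ≡⟨ *-distribʳ-+ G (2 * n) p ⟩
        -- The trivial bound `G ≤ a * a` turns the subtractive saving into the factor
        -- `2 * n / (2 * n + p)`, which can be iterated.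
        2 * n * G + p * G            ≤⟨ +-monoʳ-≤ (2 * n * G) (*-mono-≤ p≤τ (∑-≤-const A a (λ {v} _ → length-filter (free? T v) A))) ⟩
        2 * n * G + τ * (a * a)      ≤⟨ ∑-thin-≤ 2n≤a ⟩
        2 * n * (a * a)              ≡⟨ r n a ⟩
        a * (2 * n * a)              ∎
        where
        r : ∀ n a → 2 * n * (a * a) ≡ a * (2 * n * a)
        r = solve-∀

-- Inequalities between binomial coefficients.

C-monoˡ-suc : ∀ n k → n C k ≤ suc n C k
C-monoˡ-suc n zero    = ≤-refl
C-monoˡ-suc n (suc k) = ≤-trans (m≤n+m _ (n C k)) (≤-reflexive (nCk+nC[k+1]≡[n+1]C[k+1] n k))

C-monoˡ-+ : ∀ o n k → n C k ≤ (o + n) C k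
C-monoˡ-+ zero    n k = ≤-refl
C-monoˡ-+ (suc o) n k = ≤-trans (C-monoˡ-+ o n k) (C-monoˡ-suc (o + n) k)

C-monoˡ-≤ : ∀ {n o} k → n ≤ o → n C k ≤ o C k
C-monoˡ-≤ {n} {o} k n≤o = subst (λ x → n C k ≤ x C k) (m∸n+n≡m n≤o) (C-monoˡ-+ (o ∸ n) n k)

nCk≤[1+n]C[1+k] : ∀ n k → n C k ≤ suc n C suc k
nCk≤[1+n]C[1+k] n k = ≤-trans (m≤m+n _ _) (≤-reflexive (nCk+nC[k+1]≡[n+1]C[k+1] n k))

-- The left side counts the subsets of size `suc k` of `n` old and `c` new elements that use at most
-- one new element.
C-+-≥ : ∀ c n k → n C suc k + c * (n C k) ≤ (c + n) C suc k
C-+-≥ zero    n k = ≤-reflexive (+-identityʳ _)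
C-+-≥ (suc c) n k = begin
  n C suc k + (n C k + c * (n C k))  ≡⟨ rearrange (n C suc k) (n C k) (c * (n C k)) ⟩
  n C k + (n C suc k + c * (n C k))  ≤⟨ +-mono-≤ (C-monoˡ-+ c n k) (C-+-≥ c n k) ⟩
  (c + n) C k + (c + n) C suc k      ≡⟨ nCk+nC[k+1]≡[n+1]C[k+1] (c + n) k ⟩
  suc (c + n) C suc k                ∎
  where
  open ≤-Reasoning
  rearrange : ∀ x y z → x + (y + z) ≡ y + (x + z)
  rearrange = solve-∀

-- Replace each of the `n` elements by `c` copies: choosing `k` elements and a copy of each gives
-- distinct subsets of size `k`.
c^k*nCk≤[n*c]Ck : ∀ c n k → c ^ k * (n C k) ≤ (n * c) C k
c^k*nCk≤[n*c]Ck c n       zero    = ≤-refl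
c^k*nCk≤[n*c]Ck c zero    (suc k) = ≤-reflexive (*-zeroʳ (c ^ suc k))
c^k*nCk≤[n*c]Ck c (suc n) (suc k) = begin
  c ^ suc k * (suc n C suc k)                          ≡⟨ cong (c ^ suc k *_) (nCk+nC[k+1]≡[n+1]C[k+1] n k) ⟨
  c ^ suc k * (n C k + n C suc k)                      ≡⟨ distribute c (c ^ k) (n C k) (n C suc k) ⟩
  c ^ suc k * (n C suc k) + c * (c ^ k * (n C k))      ≤⟨ +-mono-≤ (c^k*nCk≤[n*c]Ck c n (suc k)) (*-monoʳ-≤ c (c^k*nCk≤[n*c]Ck c n k)) ⟩
  (n * c) C suc k + c * ((n * c) C k)                  ≤⟨ C-+-≥ c (n * c) k ⟩
  (c + n * c) C suc k                                  ∎
  where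
  open ≤-Reasoning
  distribute : ∀ c p x y → c * p * (x + y) ≡ c * p * y + c * (p * x)
  distribute = solve-∀

-- Families of sets and their traces.

module Families {V B : Set} (mem : B → V → Bool) where

  -- The members stay whole while `A` shrinks; `separated` says that the trace on `A` still
  -- determines a member, and `sized` counts only this trace.
  record Family (A : List V) (m : ℕ) (Ss : List B) : Set where
    field
      unique    : Unique Ss
      separated : ∀ {S S′} → S ∈ Ss → S′ ∈ Ss → (∀ {a} → a ∈ A → mem S a ≡ mem S′ a) → S ≡ S′
      sized     : ∀ {S} → S ∈ Ss → ∑ A (λ a → ⟦ mem S a ⟧) ≡ m

  open Family

  family-↭ : ∀ {A A′ m Ss} → A ↭ A′ → Family A m Ss → Family A′ m Ss
  family-↭ A↭A′ fam = record
    { unique    = unique fam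
    ; separated = λ S∈ S′∈ agree → separated fam S∈ S′∈ (agree ∘ ∈-resp-↭ A↭A′)
    ; sized     = λ S∈ → trans (sym (∑-↭ _ A↭A′)) (sized fam S∈)
    }

  -- Dropping points that lie in no member affects neither the sizes of the traces nor their
  -- distinctness.
  family-filter : ∀ {A m Ss} {P : V → Set} (P? : Decidable P) →
    (∀ {S x} → S ∈ Ss → x ∈ A → ¬ P x → mem S x ≡ false) →
    Family A m Ss → Family (filter P? A) m Ss
  family-filter {A} P? off fam = record
    { unique    = unique fam
    ; separated = λ S∈ S′∈ agree → separated fam S∈ S′∈ (λ {a} → extend S∈ S′∈ agree)
    ; sized     = λ S∈ → trans (∑-filter P? _ A (λ x∈A ¬Px → cong ⟦_⟧ (off S∈ x∈A ¬Px))) (sized fam S∈)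
    }
    where
    extend : ∀ {S S′} → S ∈ _ → S′ ∈ _ → (∀ {a} → a ∈ filter P? A → mem S a ≡ mem S′ a) →
             ∀ {a} → a ∈ A → mem S a ≡ mem S′ a
    extend S∈ S′∈ agree {a} a∈A with P? a
    ... | yes Pa = agree (∈-filter⁺ P? a∈A Pa)
    ... | no ¬Pa = trans (off S∈ a∈A ¬Pa) (sym (off S′∈ a∈A ¬Pa))

  at? : ∀ v b → Decidable (λ S → mem S v ≡ b)
  at? v b S = mem S v Bool.≟ b

  containing avoiding : V → List B → List B
  containing v = filter (at? v true)
  avoiding   v = filter (at? v false)

  length-split : ∀ v Ss → length Ss ≡ length (avoiding v Ss) + length (containing v Ss)
  length-split v []       = refl
  length-split v (S ∷ Ss) with mem S v
  ... | false = cong suc (length-split v Ss)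
  ... | true  = trans (cong suc (length-split v Ss)) (sym (+-suc (length (avoiding v Ss)) _))

  -- Once membership of `v` is fixed, `v` no longer tells members apart and may leave the ground
  -- list.
  family-at : ∀ {v A m m′ Ss} b → m ≡ ⟦ b ⟧ + m′ → Family (v ∷ A) m Ss → Family A m′ (filter (at? v b) Ss)
  family-at {v} {A} {m} {m′} {Ss} b m≡ fam = record
    { unique    = filter⁺ (at? v b) (unique fam)
    ; separated = λ S∈ S′∈ agree →
        let S∈Ss  , Sv≡b  = restrict S∈
            S′∈Ss , S′v≡b = restrict S′∈
        in separated fam S∈Ss S′∈Ss λ { (here refl) → trans Sv≡b (sym S′v≡b) ; (there a∈A) → agree a∈A }
    ; sized     = λ {S} S∈ →
        let S∈Ss , Sv≡b = restrict S∈
        in +-cancelˡ-≡ ⟦ b ⟧ (∑ A (λ a → ⟦ mem S a ⟧)) m′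
             (trans (cong (λ c → ⟦ c ⟧ + ∑ A (λ a → ⟦ mem S a ⟧)) (sym Sv≡b)) (trans (sized fam S∈Ss) m≡))
    }
    where
    restrict : ∀ {S} → S ∈ filter (at? v b) Ss → S ∈ Ss × mem S v ≡ b
    restrict = ∈-filter⁻ (at? v b) {xs = Ss}

  containing-empty : ∀ {v A Ss} → Family (v ∷ A) 0 Ss → containing v Ss ≡ []
  containing-empty {v} {A} {Ss} fam with containing v Ss in eq
  ... | []    = refl
  ... | S ∷ _ with ∈-filter⁻ (at? v true) {xs = Ss} (subst (S ∈_) (sym eq) (here refl))
  ...   | S∈Ss , Sv≡true = contradiction (trans (cong (λ c → ⟦ c ⟧ + ∑ A (λ a → ⟦ mem S a ⟧)) (sym Sv≡true)) (sized fam S∈Ss)) λ ()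

  -- The traces are distinct subsets of size `m`, and splitting on the first point is Pascal's rule.
  -- Over the empty list agreement is vacuous, so at most one member remains.
  length≤C : ∀ {A m Ss} → Family A m Ss → length Ss ≤ length A C m
  length≤C {[]}    {m}     {[]}         fam = z≤n
  length≤C {[]}    {m}     {S ∷ []}     fam rewrite sym (sized fam (here refl)) = ≤-refl
  length≤C {[]}    {m}     {S ∷ S′ ∷ _} fam with (S≢S′ ∷ _) ∷ _ ← unique fam =
    contradiction (separated fam (here refl) (there (here refl)) λ ()) S≢S′
  length≤C {v ∷ A} {zero}  {Ss}         fam
    rewrite length-split v Ss | containing-empty fam | +-identityʳ (length (avoiding v Ss)) =
    length≤C (family-at false refl fam)
  length≤C {v ∷ A} {suc m} {Ss}         fam = begin
    length Ss                                          ≡⟨ length-split v Ss ⟩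
    length (avoiding v Ss) + length (containing v Ss)  ≤⟨ +-mono-≤ (length≤C (family-at false refl fam)) (length≤C (family-at true refl fam)) ⟩
    length A C suc m + length A C m                    ≡⟨ +-comm (length A C suc m) _ ⟩
    length A C m + length A C suc m                    ≡⟨ nCk+nC[k+1]≡[n+1]C[k+1] (length A) m ⟩
    suc (length A) C suc m                             ∎
    where open ≤-Reasoning

-- Kleitman-Winston branching.

module Counting {V B : Set} {n : ℕ} (L : LinearSpace V n) (mem : B → V → Bool)
                (p : ℕ) .{{_ : NonZero (2 * n + p)}} where
  open LinearSpace L
  open Thinning L
  open Families mem
  open Family

  D : ℕ
  D = 2 * n

  Arc : B → Set
  Arc S = ∀ {x y z} → mem S x ≡ true → mem S y ≡ true → mem S z ≡ true →
          x ≢ y → y ≢ z → x ≢ z → slope x y ≢ slope x z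

  -- s arbitrary choices, then t choices of vertices that thin A out, remain before |A| ≤ D is forced.
  record Node (s t : ℕ) (T A : List V) (m : ℕ) (Ss : List B) : Set where
    field
      points  : Unique A
      extends : All (Extends T) A
      picked  : p ≤ length T + s
      shrunk  : length A * D ^ t ≤ D * (D + p) ^ t
      family  : Family A m Ss
      chosen  : ∀ {S} → S ∈ Ss → All (λ x → mem S x ≡ true) T
      arcs    : ∀ {S} → S ∈ Ss → Arc S

  open Node

  node-↭ : ∀ {s t T A A′ m Ss} → A ↭ A′ → Node s t T A m Ss → Node s t T A′ m Ss
  node-↭ {t = t} A↭A′ node = record
    { points  = Unique-resp-↭ (setoid V) (↭⇒↭ₛ A↭A′) (points node)
    ; extends = All-resp-↭ A↭A′ (extends node)
    ; picked  = picked node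
    ; shrunk  = subst (λ a → a * D ^ t ≤ D * (D + p) ^ t) (↭-length A↭A′) (shrunk node)
    ; family  = family-↭ A↭A′ (family node)
    ; chosen  = chosen node
    ; arcs    = arcs node
    }

  node-avoiding : ∀ {s t T v A m Ss} → Node s t T (v ∷ A) m Ss → Node s t T A m (avoiding v Ss)
  node-avoiding {t = t} {v = v} {A} {Ss = Ss} node with _ ∷ points′ ← points node | _ ∷ extends′ ← extends node = record
    { points  = points′
    ; extends = extends′
    ; picked  = picked node
    ; shrunk  = ≤-trans (*-monoˡ-≤ (D ^ t) (n≤1+n (length A))) (shrunk node)
    ; family  = family-at false refl (family node)
    ; chosen  = chosen node ∘ original
    ; arcs    = arcs node ∘ original
    }
    where
    original : ∀ {S} → S ∈ avoiding v Ss → S ∈ Ss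
    original = proj₁ ∘ ∈-filter⁻ (at? v false) {xs = Ss}

  -- A point of `A` removed by thinning lies on a line through `v` and a point of `T`, so no arc
  -- containing `v ∷ T` contains it. The two numeric facts are hypotheses, so that arbitrary and
  -- thinning choices share this step.
  node-containing : ∀ {s t s′ t′ T v A m Ss} →
    p ≤ suc (length T) + s′ → length (thin T v A) * D ^ t′ ≤ D * (D + p) ^ t′ →
    Node s t T (v ∷ A) (suc m) Ss → Node s′ t′ (v ∷ T) (thin T v A) m (containing v Ss)
  node-containing {T = T} {v} {A} {Ss = Ss} picked′ shrunk′ node
    with v∉A ∷ points′ ← points node | (v∉T , _) ∷ extends′ ← extends node = record
    { points  = filter⁺ (free? T v) points′
    ; extends = thin-extends T v A extends′
    ; picked  = picked′
    ; shrunk  = shrunk′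
    ; family  = family-filter (free? T v) excluded (family-at true refl (family node))
    ; chosen  = λ S∈ → let S∈Ss , Sv = original S∈ in Sv ∷ chosen node S∈Ss
    ; arcs    = arcs node ∘ proj₁ ∘ original
    }
    where
    original : ∀ {S} → S ∈ containing v Ss → S ∈ Ss × mem S v ≡ true
    original = ∈-filter⁻ (at? v true) {xs = Ss}

    excluded : ∀ {S x} → S ∈ containing v Ss → x ∈ A → ¬ Free T v x → mem S x ≡ false
    excluded {S} {x} S∈ x∈A ¬free with mem S x in Sx
    ... | false = refl
    ... | true  = contradiction (≢-sym v≢x , All.tabulate λ p∈T →
      arcs node S∈Ss Sx Sv (All.lookup (chosen node S∈Ss) p∈T)
        (≢-sym v≢x) (All.lookup v∉T p∈T) (All.lookup (proj₁ (All.lookup extends′ x∈A)) p∈T)) ¬free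
      where
      v≢x = All.lookup v∉A x∈A
      S∈Ss = proj₁ (original S∈)
      Sv = proj₂ (original S∈)

  -- Letting the top of the binomial grow with w makes bound-step an instance of Pascal's rule, for every m.
  bound : ℕ → ℕ → ℕ → ℕ
  bound N w m = suc N ^ w * ((D + w) C m)

  bound-monoˡ-suc : ∀ N w m → bound N w m ≤ bound (suc N) w m
  bound-monoˡ-suc N w m = *-monoˡ-≤ _ (^-monoˡ-≤ w (n≤1+n (suc N)))

  bound-step : ∀ N w m → bound N (suc w) (suc m) + bound N w m ≤ bound (suc N) (suc w) (suc m)
  bound-step N w m = begin
    suc N * M * C₁ + M * ((D + w) C m)      ≤⟨ +-monoʳ-≤ (suc N * M * C₁) (*-monoʳ-≤ M (nCk≤[1+n]C[1+k] (D + w) m)) ⟩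
    suc N * M * C₁ + M * (suc (D + w) C suc m) ≡⟨ cong (λ x → suc N * M * C₁ + M * (x C suc m)) (+-suc D w) ⟨
    suc N * M * C₁ + M * C₁                 ≡⟨ collect (suc N) M C₁ ⟩
    suc (suc N) * M * C₁                    ≤⟨ *-monoˡ-≤ C₁ (*-monoʳ-≤ (suc (suc N)) (^-monoˡ-≤ w (n≤1+n (suc N)))) ⟩
    suc (suc N) * suc (suc N) ^ w * C₁      ∎
    where
    open ≤-Reasoning
    M = suc N ^ w
    C₁ = (D + suc w) C suc m
    collect : ∀ a b c → a * b * c + b * c ≡ (1 + a) * b * c
    collect = solve-∀

  small : ∀ {s t T A m Ss} N w → length A ≤ D → Node s t T A m Ss → length Ss ≤ bound N w m
  small {m = m} N w A≤D node = ≤-trans (length≤C (family node))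
    (≤-trans (C-monoˡ-≤ m (≤-trans A≤D (m≤m+n D w))) (m≤n*m _ (suc N ^ w) {{m^n≢0 (suc N) w}}))

  mutual
    -- Recursion is on `N`, an upper bound for the number of available points: both branches at `v`
    -- remove at least `v`. Avoiding `v` spends no choice, containing it spends one.
    count : ∀ N s t {T A m Ss} → length A ≤ N → Node s t T A m Ss → length Ss ≤ bound N (s + t) m
    count N s t {A = A} A≤N node with length A ≤? D
    ... | yes A≤D = small N (s + t) A≤D node
    ... | no A≰D = large N s t A≤N (≰⇒> A≰D) node

    large : ∀ N s t {T A m Ss} → length A ≤ N → D < length A → Node s t T A m Ss → length Ss ≤ bound N (s + t) m
    -- With no choices left, `shrunk` reads `length A * 1 ≤ D * 1`.
    large N zero zero {A = A} A≤N D<A node = contradiction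
      (≤-trans (≤-reflexive (sym (*-identityʳ (length A)))) (≤-trans (shrunk node) (≤-reflexive (*-identityʳ D)))) (<⇒≱ D<A)
    -- At `s = 0`, `picked` gives `p ≤ length T`, so a vertex that thins well exists; it is permuted
    -- to the front.
    large N zero (suc t) {T} {A} A≤N D<A node
      with v , v∈A , thins ← ∃-thinning-vertex (points node) (extends node) p
             (≤-trans (picked node) (≤-reflexive (+-identityʳ (length T)))) (<⇒≤ D<A) (≤-trans (s≤s z≤n) D<A)
      with A′ , A↭ ← ∈⇒↭∷ v∈A =
      branch N zero (suc t) zero t refl A′≤N (node-↭ A↭ node) λ { refl →
        node-containing (≤-trans (picked node) (n≤1+n _)) shrunk′ (node-↭ A↭ node) }
      where
      open ≤-Reasoning
      A′≤N : suc (length A′) ≤ N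
      A′≤N = subst (_≤ N) (↭-length A↭) A≤N

      |thin|≡ : length (thin T v A) ≡ length (thin T v A′)
      |thin|≡ = trans (↭-length (filter-↭ (free? T v) A↭))
                      (cong length (filter-reject (free? T v) {v} {A′} (λ (v≢v , _) → v≢v refl)))

      -- Thinning scales the length by at most `D / (D + p)`, which pays for one factor on each side
      -- of the invariant.
      shrunk′ : length (thin T v A′) * D ^ t ≤ D * (D + p) ^ t
      shrunk′ = *-cancelʳ-≤ _ _ (D + p) (begin
        length (thin T v A′) * D ^ t * (D + p)  ≡⟨ cong (λ a → a * D ^ t * (D + p)) |thin|≡ ⟨
        length (thin T v A) * D ^ t * (D + p)   ≡⟨ r₁ (length (thin T v A)) (D ^ t) (D + p) ⟩
        (D + p) * length (thin T v A) * D ^ t   ≤⟨ *-monoˡ-≤ (D ^ t) thins ⟩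
        D * length A * D ^ t                    ≡⟨ r₂ D (length A) (D ^ t) ⟩
        length A * D ^ suc t                    ≤⟨ shrunk node ⟩
        D * (D + p) ^ suc t                     ≡⟨ r₃ D (D + p) ((D + p) ^ t) ⟩
        D * (D + p) ^ t * (D + p)               ∎)
        where
        r₁ : ∀ a b c → a * b * c ≡ c * a * b
        r₁ = solve-∀
        r₂ : ∀ a b c → a * b * c ≡ b * (a * c)
        r₂ = solve-∀
        r₃ : ∀ a b c → a * (b * c) ≡ a * c * b
        r₃ = solve-∀
    -- Any point serves here: the choice only lengthens `T`, which keeps `length T + s` constant.
    large N (suc s) t {T} {v ∷ A} A≤N D<A node =
      branch N (suc s) t s t refl A≤N node λ { refl → node-containing
        (≤-trans (picked node) (≤-reflexive (+-suc (length T) s)))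
        (≤-trans (*-monoˡ-≤ (D ^ t) (≤-trans (length-filter (free? T v) A) (n≤1+n (length A)))) (shrunk node))
        node }

    -- The equation says that containing `v` costs one unit of either budget. For `m = 0` no member
    -- contains `v`, so the second node is required only for positive `m`.
    branch : ∀ N s₀ t₀ s t → s₀ + t₀ ≡ suc (s + t) → ∀ {T v A m Ss} → suc (length A) ≤ N →
      Node s₀ t₀ T (v ∷ A) m Ss →
      (∀ {m′} → m ≡ suc m′ → Node s t (v ∷ T) (thin T v A) m′ (containing v Ss)) →
      length Ss ≤ bound N (s₀ + t₀) m
    branch (suc N) s₀ t₀ s t _ {v = v} {A} {zero} {Ss} (s≤s A≤N) node _ = begin
      length Ss                                          ≡⟨ length-split v Ss ⟩
      length (avoiding v Ss) + length (containing v Ss)  ≡⟨ cong (λ Ss′ → length (avoiding v Ss) + length Ss′) (containing-empty (family node)) ⟩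
      length (avoiding v Ss) + 0                         ≡⟨ +-identityʳ _ ⟩
      length (avoiding v Ss)                             ≤⟨ count N s₀ t₀ A≤N (node-avoiding node) ⟩
      bound N (s₀ + t₀) 0                                ≤⟨ bound-monoˡ-suc N (s₀ + t₀) 0 ⟩
      bound (suc N) (s₀ + t₀) 0                          ∎
      where open ≤-Reasoning
    branch (suc N) s₀ t₀ s t eq {T} {v} {A} {suc m} {Ss} (s≤s A≤N) node next = begin
      length Ss                                          ≡⟨ length-split v Ss ⟩
      length (avoiding v Ss) + length (containing v Ss)
        ≤⟨ +-mono-≤ (count N s₀ t₀ A≤N (node-avoiding node))
                    (count N s t (≤-trans (length-filter (free? T v) A) A≤N) (next refl)) ⟩
      bound N (s₀ + t₀) (suc m) + bound N (s + t) m      ≡⟨ cong (λ w → bound N w (suc m) + bound N (s + t) m) eq ⟩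
      bound N (suc (s + t)) (suc m) + bound N (s + t) m  ≤⟨ bound-step N (s + t) m ⟩
      bound (suc N) (suc (s + t)) (suc m)                ≡⟨ cong (λ w → bound (suc N) w (suc m)) eq ⟨
      bound (suc N) (s₀ + t₀) (suc m)                    ∎
      where open ≤-Reasoning

-- Subsets of the plane as sums over its points.

∑-allFin-suc : ∀ n (f : Fin (suc n) → ℕ) → ∑ (allFin (suc n)) f ≡ f Fin.zero + ∑ (allFin n) (f ∘ Fin.suc)
∑-allFin-suc n f = cong (f Fin.zero +_)
  (trans (cong (λ is → ∑ is f) (sym (map-tabulate id Fin.suc))) (∑-map Fin.suc f (allFin n)))

sum≡∑ : ∀ {n} (v : Vec ℕ n) → Vec.sum v ≡ ∑ (allFin n) (lookup v)
sum≡∑ []      = refl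
sum≡∑ (x ∷ v) = trans (cong (x +_) (sum≡∑ v)) (sym (∑-allFin-suc _ (lookup (x ∷ v))))

count≡∑ : ∀ {n} (v : Vec Bool n) → Vec.count (λ b → b Bool.≟ true) v ≡ ∑ (allFin n) (λ i → ⟦ lookup v i ⟧)
count≡∑ []          = refl
count≡∑ (true ∷ v)  = trans (cong suc (count≡∑ v)) (sym (∑-allFin-suc _ (λ i → ⟦ lookup (true ∷ v) i ⟧)))
count≡∑ (false ∷ v) = trans (count≡∑ v) (sym (∑-allFin-suc _ (λ i → ⟦ lookup (false ∷ v) i ⟧)))

lookup-injective : ∀ {X : Set} {n} (v w : Vec X n) → (∀ i → lookup v i ≡ lookup w i) → v ≡ w
lookup-injective v w v≗w = trans (sym (tabulate∘lookup v)) (trans (tabulate-cong v≗w) (tabulate∘lookup w))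

points : ∀ q → List (Point q)
points q = cartesianProduct (allFin q) (allFin q)

length-points : ∀ q → length (points q) ≡ q * q
length-points q = begin
  length (points q)                             ≡⟨ trans (∑-const (points q) 1) (*-identityʳ _) ⟨
  ∑ (points q) (λ _ → 1)                        ≡⟨ ∑-cartesianProduct (allFin q) (allFin q) (λ _ _ → 1) ⟩
  ∑ (allFin q) (λ _ → ∑ (allFin q) (λ _ → 1))   ≡⟨ ∑-const (allFin q) _ ⟩
  length (allFin q) * ∑ (allFin q) (λ _ → 1)    ≡⟨ cong₂ _*_ length-allFin (trans (∑-const (allFin q) 1) (trans (*-identityʳ _) length-allFin)) ⟩
  q * q                                         ∎
  where
  open ≡-Reasoning
  length-allFin : length (allFin q) ≡ q
  length-allFin = length-tabulate {n = q} id

mem : ∀ {q} → PlaneSubset q → Point q → Bool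
mem S (x , y) = lookup (lookup S x) y

size≡∑ : ∀ {q} (S : PlaneSubset q) → size S ≡ ∑ (points q) (λ P → ⟦ mem S P ⟧)
size≡∑ {q} S = begin
  Vec.sum (Vec.map (Vec.count _) S)                                       ≡⟨ sum≡∑ (Vec.map _ S) ⟩
  ∑ (allFin q) (lookup (Vec.map (Vec.count _) S))                         ≡⟨ ∑-cong (allFin q) (λ {x} _ → trans (lookup-map x _ S) (count≡∑ (lookup S x))) ⟩
  ∑ (allFin q) (λ x → ∑ (allFin q) (λ y → ⟦ lookup (lookup S x) y ⟧)) ≡⟨ ∑-cartesianProduct (allFin q) (allFin q) _ ⟨
  ∑ (points q) (λ P → ⟦ mem S P ⟧)                                    ∎
  where open ≡-Reasoning

-- The affine plane over a finite field.

module Plane {q : ℕ} (F : FiniteField q) where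
  open FiniteField F renaming (_+_ to _⊕_; _*_ to _⊗_; -_ to ⊖_)

  𝔽 : CommutativeRing _ _
  𝔽 = record { isCommutativeRing = isCommutativeRing }

  open CommutativeRing 𝔽 using (commutativeSemiring; +-group) renaming
    (+-identityˡ to ⊕-identityˡ; +-identityʳ to ⊕-identityʳ; +-assoc to ⊕-assoc; +-comm to ⊕-comm; -‿inverseʳ to ⊖-inverseʳ;
     *-assoc to ⊗-assoc; *-comm to ⊗-comm; *-identityʳ to ⊗-identityʳ; zeroˡ to ⊗-zeroˡ)
  open GroupProperties +-group using () renaming (∙-cancelˡ to ⊕-cancelˡ)
  module Solver = SemiringSolver commutativeSemiring

  -- Direction zero is that of the vertical lines x = c, direction suc t that of the lines t x + y = c.
  coeffs : Fin (suc q) → Fin q × Fin q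
  coeffs Fin.zero    = 1# , 0#
  coeffs (Fin.suc t) = t , 1#

  -- The lines of direction `d` are the level sets of this linear form.
  level : Fin (suc q) → Point q → Fin q
  level d (x , y) = (proj₁ (coeffs d) ⊗ x) ⊕ (proj₂ (coeffs d) ⊗ y)

  -- Writing a coordinate as another plus a difference turns comparisons of levels into semiring
  -- identities with the difference as a variable.
  difference : ∀ x y → y ≡ x ⊕ (y ⊕ (⊖ x))
  difference x y = begin
    y                  ≡⟨ ⊕-identityʳ y ⟨
    y ⊕ 0#             ≡⟨ cong (y ⊕_) (⊖-inverseʳ x) ⟨
    y ⊕ (x ⊕ (⊖ x))    ≡⟨ ⊕-assoc y x (⊖ x) ⟨
    (y ⊕ x) ⊕ (⊖ x)    ≡⟨ cong (_⊕ (⊖ x)) (⊕-comm y x) ⟩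
    (x ⊕ y) ⊕ (⊖ x)    ≡⟨ ⊕-assoc x y (⊖ x) ⟩
    x ⊕ (y ⊕ (⊖ x))    ∎
    where open ≡-Reasoning

  difference≢0 : ∀ {x y} → x ≢ y → y ⊕ (⊖ x) ≢ 0#
  difference≢0 {x} {y} x≢y d≡0 = x≢y (sym (trans (difference x y) (trans (cong (x ⊕_) d≡0) (⊕-identityʳ x))))

  level-upper : ∀ t x y e → level (Fin.suc t) (x , y ⊕ e) ≡ ((t ⊗ x) ⊕ y) ⊕ e
  level-upper = solve 4 (λ t x y e → (t :* x) :+ (con 1 :* (y :+ e)) := ((t :* x) :+ y) :+ e) refl
    where open Solver

  level-right : ∀ t x y d → level (Fin.suc t) (x ⊕ d , y) ≡ ((t ⊗ x) ⊕ y) ⊕ (t ⊗ d)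
  level-right = solve 4 (λ t x y d → (t :* (x :+ d)) :+ (con 1 :* y) := ((t :* x) :+ y) :+ (t :* d)) refl
    where open Solver

  level-zero : ∀ x y → level Fin.zero (x , y) ≡ x
  level-zero = solve 2 (λ x y → (con 1 :* x) :+ (con 0 :* y) := x) refl
    where open Solver

  module _ (x₁ y₁ x₂ y₂ : Fin q) where
    private
      -- Opposite orientations for `d` and `e`: equality of `t x₁ + y₁` and `t x₂ + y₂` is
      -- `t d = e`. Both levels are measured from `t x₁ + y₂`.
      d = x₂ ⊕ (⊖ x₁)
      e = y₁ ⊕ (⊖ y₂)
      P = x₁ , y₁
      Q = x₂ , y₂

    level-P : ∀ t → level (Fin.suc t) P ≡ ((t ⊗ x₁) ⊕ y₂) ⊕ e
    level-P t = trans (cong (λ y → level (Fin.suc t) (x₁ , y)) (difference y₂ y₁)) (level-upper t x₁ y₂ e)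

    level-Q : ∀ t → level (Fin.suc t) Q ≡ ((t ⊗ x₁) ⊕ y₂) ⊕ (t ⊗ d)
    level-Q t = trans (cong (λ x → level (Fin.suc t) (x , y₂)) (difference x₁ x₂)) (level-right t x₁ y₂ d)

    rise⇒level : ∀ t → t ⊗ d ≡ e → level (Fin.suc t) P ≡ level (Fin.suc t) Q
    rise⇒level t td≡e = trans (level-P t) (trans (cong (((t ⊗ x₁) ⊕ y₂) ⊕_) (sym td≡e)) (sym (level-Q t)))

    level⇒rise : ∀ t → level (Fin.suc t) P ≡ level (Fin.suc t) Q → t ⊗ d ≡ e
    level⇒rise t same = sym (⊕-cancelˡ ((t ⊗ x₁) ⊕ y₂) e (t ⊗ d) (trans (sym (level-P t)) (trans same (level-Q t))))

  divide : ∀ {d} → d ≢ 0# → Fin q → Fin q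
  divide d≢0 e = e ⊗ proj₁ (inverse _ d≢0)

  divide-⊗ : ∀ {d} (d≢0 : d ≢ 0#) e → divide d≢0 e ⊗ d ≡ e
  divide-⊗ {d} d≢0 e with i , di≡1 ← inverse d d≢0 =
    trans (⊗-assoc e i d) (trans (cong (e ⊗_) (trans (⊗-comm i d) di≡1)) (⊗-identityʳ e))

  ⊗-cancelʳ : ∀ {d} → d ≢ 0# → ∀ t u → t ⊗ d ≡ u ⊗ d → t ≡ u
  ⊗-cancelʳ {d} d≢0 t u td≡ud with i , di≡1 ← inverse d d≢0 = trans (undo t) (trans (cong (_⊗ i) td≡ud) (sym (undo u)))
    where
    undo : ∀ s → s ≡ (s ⊗ d) ⊗ i
    undo s = sym (trans (⊗-assoc s d i) (trans (cong (s ⊗_) di≡1) (⊗-identityʳ s)))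

  -- Slanted lines are `t x + y = c`, so `t` is the negative of the usual slope.
  slope : Point q → Point q → Fin (suc q)
  slope (x₁ , y₁) (x₂ , y₂) with x₁ Fin.≟ x₂
  ... | yes _    = Fin.zero
  ... | no x₁≢x₂ = Fin.suc (divide (difference≢0 x₁≢x₂) (y₁ ⊕ (⊖ y₂)))

  level-slope : ∀ P Q → level (slope P Q) P ≡ level (slope P Q) Q
  level-slope (x₁ , y₁) (x₂ , y₂) with x₁ Fin.≟ x₂
  ... | yes refl = trans (level-zero x₁ y₁) (sym (level-zero x₁ y₂))
  ... | no x₁≢x₂ = rise⇒level x₁ y₁ x₂ y₂ _ (divide-⊗ (difference≢0 x₁≢x₂) _)

  slanted-injective : ∀ t x {y₁ y₂} → level (Fin.suc t) (x , y₁) ≡ level (Fin.suc t) (x , y₂) → y₁ ≡ y₂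
  slanted-injective t x {y₁} {y₂} same = trans (sym (1⊗ y₁)) (trans (⊕-cancelˡ (t ⊗ x) _ _ same) (1⊗ y₂))
    where
    1⊗ : ∀ y → 1# ⊗ y ≡ y
    1⊗ y = trans (⊗-comm 1# y) (⊗-identityʳ y)

  vertical≢slanted : ∀ {P Q} t → P ≢ Q → level Fin.zero P ≡ level Fin.zero Q → level (Fin.suc t) P ≢ level (Fin.suc t) Q
  vertical≢slanted {x₁ , y₁} {x₂ , y₂} t P≢Q vert slant
    with refl ← trans (sym (level-zero x₁ y₁)) (trans vert (level-zero x₂ y₂)) =
    P≢Q (cong (x₁ ,_) (slanted-injective t x₁ slant))

  -- When the abscissas differ, `t d = e` with nonzero `d` determines `t`; when they agree, no
  -- slanted line joins distinct points. Slopes are identified by finding a direction with equal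
  -- levels.
  direction-unique : ∀ {P Q} → P ≢ Q → ∀ d d′ → level d P ≡ level d Q → level d′ P ≡ level d′ Q → d ≡ d′
  direction-unique P≢Q Fin.zero    Fin.zero    _ _  = refl
  direction-unique P≢Q Fin.zero    (Fin.suc u) l l′ = contradiction l′ (vertical≢slanted u P≢Q l)
  direction-unique P≢Q (Fin.suc t) Fin.zero    l l′ = contradiction l (vertical≢slanted t P≢Q l′)
  direction-unique {x₁ , y₁} {x₂ , y₂} P≢Q (Fin.suc t) (Fin.suc u) l l′ with x₁ Fin.≟ x₂
  ... | yes refl = contradiction (cong (x₁ ,_) (slanted-injective t x₁ l)) P≢Q
  ... | no x₁≢x₂ = cong Fin.suc (⊗-cancelʳ (difference≢0 x₁≢x₂) t u
    (trans (level⇒rise x₁ y₁ x₂ y₂ t l) (sym (level⇒rise x₁ y₁ x₂ y₂ u l′))))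

  linearSpace : LinearSpace (Point q) (suc q)
  linearSpace = record
    { _≟_            = _≟ₚ_
    ; slope          = slope
    ; slope-sym      = slope-sym
    ; slope-transfer = slope-transfer
    }
    where
    _≟ₚ_ : DecidableEquality (Point q)
    _≟ₚ_ = ≡-dec Fin._≟_ Fin._≟_

    slope-sym : ∀ P Q → slope P Q ≡ slope Q P
    slope-sym P Q with P ≟ₚ Q
    ... | yes refl = refl
    ... | no P≢Q   = direction-unique P≢Q _ _ (level-slope P Q) (sym (level-slope Q P))

    -- Both `Q` and `R` lie on the line through `P` of direction `slope P Q`, which is therefore the
    -- line through `Q` and `R`.
    slope-transfer : ∀ {P Q R} → P ≢ Q → Q ≢ R → P ≢ R → slope P Q ≡ slope P R → slope Q R ≡ slope Q P
    slope-transfer {P} {Q} {R} _ Q≢R _ same = trans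
      (direction-unique Q≢R (slope Q R) (slope P Q) (level-slope Q R)
        (trans (sym (level-slope P Q)) (subst (λ d → level d P ≡ level d R) (sym same) (level-slope P R))))
      (slope-sym P Q)

  slope⇒collinear : ∀ P Q R → slope P Q ≡ slope P R → Collinear F P Q R
  slope⇒collinear P Q R same = proj₁ (coeffs d) , proj₂ (coeffs d) , level d P , nonzero d ,
    refl , sym (level-slope P Q) , sym (subst (λ d → level d P ≡ level d R) (sym same) (level-slope P R))
    where
    d = slope P Q
    nonzero : ∀ d → ¬ (proj₁ (coeffs d) ≡ 0# × proj₂ (coeffs d) ≡ 0#)
    nonzero Fin.zero    (1≡0 , _) = 0≢1 (sym 1≡0)
    nonzero (Fin.suc _) (_ , 1≡0) = 0≢1 (sym 1≡0)

  count-general-position : ∀ p t → (q * q) * (2 * suc q) ^ t ≤ 2 * suc q * (2 * suc q + p) ^ t →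
    ∀ {m Ss} → Unique Ss → All (λ S → size S ≡ m × GeneralPosition F S) Ss →
    length Ss ≤ suc (q * q) ^ (p + t) * ((2 * suc q + (p + t)) C m)
  count-general-position p t fits {m} {Ss} unique valid =
    -- The root of the branching: nothing chosen, the whole plane available. The hypothesis `fits`
    -- is its `shrunk` field.
    count (q * q) p t (≤-reflexive (length-points q)) record
      { points  = cartesianProduct⁺ (allFin⁺ q) (allFin⁺ q)
      ; extends = All.tabulate λ _ → [] , []
      ; picked  = ≤-refl
      ; shrunk  = subst (λ a → a * (2 * suc q) ^ t ≤ 2 * suc q * (2 * suc q + p) ^ t) (sym (length-points q)) fits
      ; family  = record
        { unique    = unique
        ; separated = λ {S} {S′} _ _ agree → lookup-injective S S′ λ x → lookup-injective _ _ λ y →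
                        agree (∈-cartesianProduct⁺ (∈-allFin x) (∈-allFin y))
        ; sized     = λ {S} S∈ → trans (sym (size≡∑ S)) (proj₁ (All.lookup valid S∈))
        }
      ; chosen  = λ _ → []
      ; arcs    = λ S∈ Sx Sy Sz x≢y y≢z x≢z same →
                    proj₂ (All.lookup valid S∈) _ _ _ Sx Sy Sz x≢y y≢z x≢z (slope⇒collinear _ _ _ same)
      }
    where open Counting linearSpace mem p

-- How many thinnings halve the available points.

-- Bernoulli's inequality `1 + h x ≤ (1 + x) ^ h` at `x = p / D`, multiplied by `D ^ suc h`.
bernoulli : ∀ D p h → (D + h * p) * D ^ h ≤ D * (D + p) ^ h
bernoulli D p zero    = ≤-reflexive (cong (_* 1) (+-identityʳ D))
bernoulli D p (suc h) = begin
  (D + (p + h * p)) * (D * D ^ h)                          ≤⟨ m≤m+n _ (p * (h * p) * D ^ h) ⟩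
  (D + (p + h * p)) * (D * D ^ h) + p * (h * p) * D ^ h    ≡⟨ factor D p (h * p) (D ^ h) ⟩
  (D + p) * ((D + h * p) * D ^ h)                          ≤⟨ *-monoʳ-≤ (D + p) (bernoulli D p h) ⟩
  (D + p) * (D * (D + p) ^ h)                              ≡⟨ swap (D + p) D ((D + p) ^ h) ⟩
  D * ((D + p) * (D + p) ^ h)                              ∎
  where
  open ≤-Reasoning
  factor : ∀ D p r x → (D + (p + r)) * (D * x) + p * r * x ≡ (D + p) * ((D + r) * x)
  factor = solve-∀
  swap : ∀ a b c → a * (b * c) ≡ b * (a * c)
  swap = solve-∀

2*D^h≤[D+p]^h : ∀ D p h .{{_ : NonZero D}} → D ≤ h * p → 2 * D ^ h ≤ (D + p) ^ h
2*D^h≤[D+p]^h D p h D≤hp = *-cancelˡ-≤ D (begin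
  D * (2 * D ^ h)      ≡⟨ double D (D ^ h) ⟩
  (D + D) * D ^ h      ≤⟨ *-monoˡ-≤ (D ^ h) (+-monoʳ-≤ D D≤hp) ⟩
  (D + h * p) * D ^ h  ≤⟨ bernoulli D p h ⟩
  D * (D + p) ^ h      ∎)
  where
  open ≤-Reasoning
  double : ∀ D x → D * (2 * x) ≡ (D + D) * x
  double = solve-∀

2^j*D^[j*h]≤[D+p]^[j*h] : ∀ D p h j .{{_ : NonZero D}} → D ≤ h * p → 2 ^ j * D ^ (j * h) ≤ (D + p) ^ (j * h)
2^j*D^[j*h]≤[D+p]^[j*h] D p h zero    D≤hp = ≤-refl
2^j*D^[j*h]≤[D+p]^[j*h] D p h (suc j) D≤hp = begin
  2 * 2 ^ j * D ^ (h + j * h)            ≡⟨ cong (2 * 2 ^ j *_) (^-distribˡ-+-* D h (j * h)) ⟩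
  2 * 2 ^ j * (D ^ h * D ^ (j * h))      ≡⟨ interchange 2 (2 ^ j) (D ^ h) (D ^ (j * h)) ⟩
  2 * D ^ h * (2 ^ j * D ^ (j * h))      ≤⟨ *-mono-≤ (2*D^h≤[D+p]^h D p h D≤hp) (2^j*D^[j*h]≤[D+p]^[j*h] D p h j D≤hp) ⟩
  (D + p) ^ h * (D + p) ^ (j * h)        ≡⟨ ^-distribˡ-+-* (D + p) h (j * h) ⟨
  (D + p) ^ (h + j * h)                  ∎
  where
  open ≤-Reasoning
  interchange : ∀ a b c d → a * b * (c * d) ≡ a * c * (b * d)
  interchange = solve-∀

-- Integer square roots and logarithms.

m²≤n²⇒m≤n : ∀ {m n} → m * m ≤ n * n → m ≤ n
m²≤n²⇒m≤n {m} {n} m²≤n² with m ≤? n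
... | yes m≤n = m≤n
... | no m≰n  = contradiction m²≤n² (<⇒≱ (*-mono-< (≰⇒> m≰n) (≰⇒> m≰n)))

-- The root grows only when its square falls short, and then `(r + 1)² ≤ 2 (r² + 1)` gives the upper
-- bound.
∃-root : ∀ n → ∃[ r ] (n ≤ r * r × r * r ≤ 2 * n)
∃-root zero    = 0 , z≤n , z≤n
∃-root (suc n) with r , n≤r² , r²≤2n ← ∃-root n with suc n ≤? r * r
... | yes 1+n≤r² = r , 1+n≤r² , ≤-trans r²≤2n (*-monoʳ-≤ 2 (n≤1+n n))
... | no 1+n≰r²  = suc r , ≤-trans (s≤s n≤r²) 1+r²≤[1+r]² , (begin
  suc r * suc r            ≡⟨ expand r ⟩
  2 * (r * 1) + (r * r + 1) ≤⟨ +-monoˡ-≤ (r * r + 1) (2*m*n≤m²+n² r 1) ⟩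
  r * r + 1 + (r * r + 1)  ≡⟨ collect (r * r) ⟩
  2 * suc (r * r)          ≤⟨ *-monoʳ-≤ 2 (≰⇒> 1+n≰r²) ⟩
  2 * suc n                ∎)
  where
  open ≤-Reasoning
  expand : ∀ r → (1 + r) * (1 + r) ≡ 2 * (r * 1) + (r * r + 1)
  expand = solve-∀
  collect : ∀ x → x + 1 + (x + 1) ≡ 2 * (1 + x)
  collect = solve-∀
  1+r²≤[1+r]² : suc (r * r) ≤ suc r * suc r
  1+r²≤[1+r]² = s≤s (≤-trans (*-monoʳ-≤ r (n≤1+n r)) (m≤n+m _ r))

-- The left inequality is strict to match the hypothesis `2 ^ a < q ^ b` in `LargeEnough`, taken at
-- `a = k` and `b = 1`.
∃-log₂ : ∀ n → 2 ≤ n → ∃[ k ] (2 ^ k < n × n ≤ 2 ^ suc k)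
∃-log₂ (suc zero)            (s≤s ())
∃-log₂ (suc (suc zero))      2≤n = 0 , ≤-refl , ≤-refl
∃-log₂ (suc n@(suc (suc _))) 2≤n with k , 2^k<n , n≤2^[1+k] ← ∃-log₂ n (s≤s (s≤s z≤n)) with suc n ≤? 2 ^ suc k
... | yes 1+n≤ = k , m≤n⇒m≤1+n 2^k<n , 1+n≤
... | no 1+n≰  = suc k , ≰⇒> 1+n≰ , (begin
  suc n              ≤⟨ s≤s n≤2^[1+k] ⟩
  1 + 2 ^ suc k      ≤⟨ +-monoˡ-≤ (2 ^ suc k) (m^n>0 2 (suc k)) ⟩
  2 ^ suc k + 2 ^ suc k ≡⟨ cong (2 ^ suc k +_) (+-identityʳ _) ⟨
  2 ^ suc (suc k)    ∎)
  where open ≤-Reasoning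

-- Here k = 11 + j.
8*[k+2]²≤2^k : ∀ j → 8 * ((13 + j) * (13 + j)) ≤ 2 ^ (11 + j)
8*[k+2]²≤2^k zero    = m≤m+n 1352 696
8*[k+2]²≤2^k (suc j) = begin
  8 * ((13 + suc j) * (13 + suc j))                                        ≤⟨ m≤m+n _ _ ⟩
  8 * ((13 + suc j) * (13 + suc j)) + 8 * (142 + 24 * j + j * j)           ≡⟨ double j ⟩
  2 * (8 * ((13 + j) * (13 + j)))                                          ≤⟨ *-monoʳ-≤ 2 (8*[k+2]²≤2^k j) ⟩
  2 * 2 ^ (11 + j)                                                         ∎
  where
  open ≤-Reasoning
  double : ∀ j → 8 * ((13 + (1 + j)) * (13 + (1 + j))) + 8 * (142 + 24 * j + j * j) ≡ 2 * (8 * ((13 + j) * (13 + j)))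
  double = solve-∀

-- Choice of parameters and the final estimate.

module Parameters {q : ℕ} (m k r : ℕ) (2^k<q : 2 ^ k < q) (q≤2^[1+k] : q ≤ 2 ^ suc k) (q-large : 2 ^ 12 ≤ q)
                  (r-lower : 2 * suc q ≤ r * r) (r-upper : r * r ≤ 8 * q)
                  (large : LargeEnough q m) where
  open ≤-Reasoning

  11≤k : 11 ≤ k
  11≤k with 11 ≤? k
  ... | yes 11≤k = 11≤k
  ... | no 11≰k  = contradiction (≤-trans q-large (≤-trans q≤2^[1+k] (^-monoʳ-≤ 2 (≰⇒> 11≰k)))) (<⇒≱ (^-monoʳ-< 2 ≤-refl {11} {12} ≤-refl))

  -- With `p = r` and `2 * suc q ≤ r * r`, each round of `r` thinnings halves the bound; `suc k`
  -- rounds gain `2 ^ suc k`, which is at least `q`.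
  fits : q * q * (2 * suc q) ^ (suc k * r) ≤ 2 * suc q * (2 * suc q + r) ^ (suc k * r)
  fits = begin
    q * q * (2 * suc q) ^ t             ≡⟨ *-assoc q q _ ⟩
    q * (q * (2 * suc q) ^ t)           ≤⟨ *-mono-≤ (≤-trans (n≤1+n q) (m≤n*m (suc q) 2)) (*-monoˡ-≤ ((2 * suc q) ^ t) q≤2^[1+k]) ⟩
    2 * suc q * (2 ^ suc k * (2 * suc q) ^ t) ≤⟨ *-monoʳ-≤ (2 * suc q) (2^j*D^[j*h]≤[D+p]^[j*h] (2 * suc q) r r (suc k) r-lower) ⟩
    2 * suc q * (2 * suc q + r) ^ t     ∎
    where t = suc k * r

  -- The total number of choices, which unfolds to `(2 + k) * r`.
  w : ℕ
  w = r + suc k * r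

  8*[2+k]²≤q : 8 * ((2 + k) * (2 + k)) ≤ q
  8*[2+k]²≤q with j , refl ← m≤n⇒∃[o]m+o≡n 11≤k = ≤-trans (8*[k+2]²≤2^k j) (<⇒≤ 2^k<q)

  w≤q : w ≤ q
  w≤q = m²≤n²⇒m≤n (begin
    (2 + k) * r * ((2 + k) * r)         ≡⟨ square (2 + k) r ⟩
    (2 + k) * (2 + k) * (r * r)         ≤⟨ *-monoʳ-≤ ((2 + k) * (2 + k)) r-upper ⟩
    (2 + k) * (2 + k) * (8 * q)         ≡⟨ move ((2 + k) * (2 + k)) q ⟩
    8 * ((2 + k) * (2 + k)) * q         ≤⟨ *-monoˡ-≤ q 8*[2+k]²≤q ⟩
    q * q                               ∎)
    where
    square : ∀ a r → a * r * (a * r) ≡ a * a * (r * r)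
    square = solve-∀
    move : ∀ a q → a * (8 * q) ≡ 8 * a * q
    move = solve-∀

  top≤4q : 2 * suc q + w ≤ 4 * q
  top≤4q = begin
    2 * suc q + w      ≤⟨ +-monoʳ-≤ (2 * suc q) w≤q ⟩
    2 * suc q + q      ≡⟨ expand q ⟩
    3 * q + 2          ≤⟨ +-monoʳ-≤ (3 * q) (≤-trans (m≤m+n 2 4094) q-large) ⟩
    3 * q + q          ≡⟨ collect q ⟩
    4 * q              ∎
    where
    expand : ∀ q → 2 * (1 + q) + q ≡ 3 * q + 2
    expand = solve-∀
    collect : ∀ q → 3 * q + q ≡ 4 * q
    collect = solve-∀

  -- Here `m ≥ √q (log q)²` enters. Squares are compared, and 3 is the least integer whose square is
  -- at least the 8 from `r-upper`.
  r*k²≤3*m : r * (k * k) ≤ 3 * m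
  r*k²≤3*m = m²≤n²⇒m≤n (begin
    r * (k * k) * (r * (k * k))      ≡⟨ square r k ⟩
    r * r * k ^ 4                    ≤⟨ *-monoˡ-≤ (k ^ 4) r-upper ⟩
    8 * q * k ^ 4                    ≡⟨ move q (k ^ 4) ⟩
    8 * (k ^ 4 * q)                  ≤⟨ *-monoʳ-≤ 8 (<⇒≤ (large k 1 ≤-refl (subst (2 ^ k <_) (sym (^-identityʳ q)) 2^k<q))) ⟩
    8 * (m ^ 2 * 1 ^ 4)              ≤⟨ *-monoˡ-≤ (m ^ 2 * 1 ^ 4) (n≤1+n 8) ⟩
    9 * (m ^ 2 * 1 ^ 4)              ≡⟨ square₃ m ⟩
    3 * m * (3 * m)                  ∎)
    where
    square : ∀ r k → r * (k * k) * (r * (k * k)) ≡ r * r * (k * (k * (k * (k * 1))))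
    square = solve-∀
    move : ∀ q x → 8 * q * x ≡ 8 * (x * q)
    move = solve-∀
    square₃ : ∀ m → 9 * (m * (m * 1) * 1) ≡ 3 * m * (3 * m)
    square₃ = solve-∀

  [3+2k]*[2+k]≤3k² : (3 + 2 * k) * (2 + k) ≤ 3 * (k * k)
  [3+2k]*[2+k]≤3k² with j , refl ← m≤n⇒∃[o]m+o≡n 11≤k = begin
    -- The slack `k² - 7 k - 6` at `k = 11 + j` is `j² + 15 j + 38`.
    (3 + 2 * (11 + j)) * (2 + (11 + j))                       ≤⟨ m≤m+n _ _ ⟩
    (3 + 2 * (11 + j)) * (2 + (11 + j)) + (j * j + 15 * j + 38) ≡⟨ total j ⟩
    3 * ((11 + j) * (11 + j))                                 ∎
    where
    total : ∀ j → (3 + 2 * (11 + j)) * (2 + (11 + j)) + (j * j + 15 * j + 38) ≡ 3 * ((11 + j) * (11 + j))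
    total = solve-∀

  -- Since `suc (q * q) ≤ 2 ^ (3 + 2 * k)`, this makes the cost of all choices at most
  -- `2 ^ (9 * m)`.
  exponent≤9m : (3 + 2 * k) * w ≤ 9 * m
  exponent≤9m = begin
    (3 + 2 * k) * ((2 + k) * r)   ≡⟨ *-assoc (3 + 2 * k) (2 + k) r ⟨
    (3 + 2 * k) * (2 + k) * r     ≤⟨ *-monoˡ-≤ r [3+2k]*[2+k]≤3k² ⟩
    3 * (k * k) * r               ≡⟨ move (k * k) r ⟩
    3 * (r * (k * k))             ≤⟨ *-monoʳ-≤ 3 r*k²≤3*m ⟩
    3 * (3 * m)                   ≡⟨ *-assoc 3 3 m ⟨
    9 * m                         ∎
    where
    move : ∀ x r → 3 * x * r ≡ 3 * (r * x)
    move = solve-∀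

  1+q²≤2^[3+2k] : suc (q * q) ≤ 2 ^ (3 + 2 * k)
  1+q²≤2^[3+2k] = begin
    1 + q * q                      ≤⟨ +-mono-≤ (*-mono-≤ 0<2^[1+k] 0<2^[1+k]) (*-mono-≤ q≤2^[1+k] q≤2^[1+k]) ⟩
    2 ^ suc k * 2 ^ suc k + 2 ^ suc k * 2 ^ suc k  ≡⟨ collect (2 ^ k) ⟩
    8 * (2 ^ k * (2 ^ k * 1))      ≡⟨ cong (8 *_) (^-*-assoc 2 k 2) ⟩
    8 * 2 ^ (k * 2)                ≡⟨ cong (λ e → 8 * 2 ^ e) (*-comm k 2) ⟩
    8 * 2 ^ (2 * k)                ≡⟨ ^-distribˡ-+-* 2 3 (2 * k) ⟨
    2 ^ (3 + 2 * k)                ∎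
    where
    0<2^[1+k] = m^n>0 2 (suc k)
    collect : ∀ x → 2 * x * (2 * x) + 2 * x * (2 * x) ≡ 8 * (x * (x * 1))
    collect = solve-∀

  bound≤ : suc (q * q) ^ w * ((2 * suc q + w) C m) ≤ (2 ^ 9 * 4 * q) C m
  bound≤ = begin
    suc (q * q) ^ w * ((2 * suc q + w) C m)       ≤⟨ *-mono-≤ (^-monoˡ-≤ w 1+q²≤2^[3+2k]) (C-monoˡ-≤ m top≤4q) ⟩
    (2 ^ (3 + 2 * k)) ^ w * ((4 * q) C m)         ≡⟨ cong (_* ((4 * q) C m)) (^-*-assoc 2 (3 + 2 * k) w) ⟩
    2 ^ ((3 + 2 * k) * w) * ((4 * q) C m)         ≤⟨ *-monoˡ-≤ _ (^-monoʳ-≤ 2 exponent≤9m) ⟩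
    2 ^ (9 * m) * ((4 * q) C m)                   ≡⟨ cong (_* ((4 * q) C m)) (^-*-assoc 2 9 m) ⟨
    (2 ^ 9) ^ m * ((4 * q) C m)                   ≤⟨ c^k*nCk≤[n*c]Ck (2 ^ 9) (4 * q) m ⟩
    (4 * q * 2 ^ 9) C m                           ≡⟨ cong (_C m) (trans (*-comm (4 * q) (2 ^ 9)) (sym (*-assoc (2 ^ 9) 4 q))) ⟩
    (2 ^ 9 * 4 * q) C m                           ∎

theorem1p5 : ∃[ c ] (0 < c × ∃[ q₀ ] (∀ q → q₀ ≤ q → (F : FiniteField q) →
    ∀ m → LargeEnough q m →
    (Ss : List (PlaneSubset q)) → Unique Ss →
    All (λ S → size S ≡ m × GeneralPosition F S) Ss →
    length Ss ≤ (c * q) C m))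
-- The factor 4 comes from `top≤4q` and `2 ^ 9` from `exponent≤9m`. The threshold `2 ^ 12` forces
-- `11 ≤ k`, the first value with `8 (k + 2)² ≤ 2 ^ k`.
theorem1p5 = 2 ^ 9 * 4 , s≤s z≤n , 2 ^ 12 , λ q q₀≤q F m large Ss unique valid →
  let k , 2^k<q , q≤2^[1+k] = ∃-log₂ q (≤-trans (m≤m+n 2 4094) q₀≤q)
      r , r-lower , r-upper = ∃-root (2 * suc q)
      r-upper′ = ≤-trans r-upper (4*[1+q]≤8*q (≤-trans (m≤m+n 1 4095) q₀≤q))
      open Parameters m k r 2^k<q q≤2^[1+k] q₀≤q r-lower r-upper′ large
  in ≤-trans (Plane.count-general-position F r (suc k * r) fits unique valid) bound≤
  where
  4*[1+q]≤8*q : ∀ {q} → 1 ≤ q → 2 * (2 * suc q) ≤ 8 * q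
  4*[1+q]≤8*q {q} 1≤q = begin
    2 * (2 * suc q)   ≡⟨ expand q ⟩
    4 * q + 4 * 1     ≤⟨ +-monoʳ-≤ (4 * q) (*-monoʳ-≤ 4 1≤q) ⟩
    4 * q + 4 * q     ≡⟨ collect q ⟩
    8 * q             ∎
    where
    open ≤-Reasoning
    expand : ∀ q → 2 * (2 * (1 + q)) ≡ 4 * q + 4 * 1
    expand = solve-∀
    collect : ∀ q → 4 * q + 4 * q ≡ 8 * q
    collect = solve-∀
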